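{- For every graph $G$, $$\Omega_1(G)\le \tfrac{1}{2}\Omega_{2}(G)\le \tfrac{1}{3}\Omega_{3}(G) \le \cdots \le |V(G)|;$$ that is, for every positive integer $m$, $\frac{1}{m}\Omega_m(G)\le \frac{1}{m+1}\Omega_{m+1}(G)\le |V(G)|$.
   Context: Graphs are finite, loopless, and may have multiple edges. A graph is $m$-tree-connected if it contains $m$ pairwise edge-disjoint spanning trees (a one-vertex graph is $m$-tree-connected). The $m$-tree-connected components of $G$ are its maximal induced $m$-tree-connected subgraphs; their vertex sets partition $V(G)$. For a partition $P$ of $V(G)$, $e_G(P)$ is the number of edges with ends in different parts. $\Omega_m(G)=m|P|-e_G(P)$ where $P$ is the partition into vertex sets of the $m$-tree-connected components (so $\Omega_1(G)$ is the number of components of $G$). -}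

module Defs where

open import Data.Nat using (ℕ; suc; _*_)
open import Data.Fin using (Fin)
import Data.Fin as Fin
open import Data.Integer using (ℤ; +_; _-_)
open import Data.Product using (Σ; ∃; _×_; _,_; proj₁; proj₂)
open import Data.Sum using (_⊎_)
open import Data.List using (List; length; filter)
open import Data.List.Base using (allFin)
open import Relation.Nullary using (¬_)
open import Relation.Nullary.Decidable using (¬?)
open import Relation.Binary.PropositionalEquality using (_≡_; _≢_)

record Graph : Set where
  field
    n        : ℕ
    ne       : ℕ
    ends     : Fin ne → Fin n × Fin n
    loopless : ∀ e → proj₁ (ends e) ≢ proj₂ (ends e)
open Graph public

module _ (G : Graph) where

  Joins : Fin (ne G) → Fin (n G) → Fin (n G) → Set
  Joins e u w = (ends G e ≡ (u , w)) ⊎ (ends G e ≡ (w , u))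

  data Reach (T : Fin (ne G) → Set) : Fin (n G) → Fin (n G) → Set where
    here : ∀ {u} → Reach T u u
    step : ∀ {u w v} (e : Fin (ne G)) → T e → Joins e u w → Reach T w v → Reach T u v

  -- T is (the edge set of) a spanning tree of the induced subgraph G[S]:
  -- its edges lie in G[S], it connects all of S, and it is acyclic
  -- (no edge's ends are still connected after deleting that edge).
  IsSpanningTree : (Fin (n G) → Set) → (Fin (ne G) → Set) → Set
  IsSpanningTree S T =
    (∀ e → T e → S (proj₁ (ends G e)) × S (proj₂ (ends G e))) ×
    (∀ u v → S u → S v → Reach T u v) ×
    (∀ e → T e → ¬ Reach (λ f → T f × f ≢ e) (proj₁ (ends G e)) (proj₂ (ends G e)))

  TreeConnected : ℕ → (Fin (n G) → Set) → Set₁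
  TreeConnected m S =
    Σ (Fin m → Fin (ne G) → Set) λ Ts →
      (∀ i → IsSpanningTree S (Ts i)) ×
      (∀ i j e → Ts i e → Ts j e → i ≡ j)

  -- c : Fin n → Fin k labels the parts of a partition with k (nonempty) parts;
  -- it is the partition into the vertex sets of the m-tree-connected
  -- components, i.e. every part is a maximal vertex set inducing an
  -- m-tree-connected subgraph.
  IsComponentPartition : ℕ → (k : ℕ) → (Fin (n G) → Fin k) → Set₁
  IsComponentPartition m k c =
    (∀ i → ∃ λ v → c v ≡ i) ×
    (∀ i → TreeConnected m (λ v → c v ≡ i) ×
           (∀ (S : Fin (n G) → Set) → (∀ v → c v ≡ i → S v) →
              TreeConnected m S → ∀ v → S v → c v ≡ i))

  crossing : {k : ℕ} → (Fin (n G) → Fin k) → ℕ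
  crossing c = length (filter (λ e → ¬? (c (proj₁ (ends G e)) Fin.≟ c (proj₂ (ends G e)))) (allFin (ne G)))

  Omega : (m k : ℕ) → (Fin (n G) → Fin k) → ℤ
  Omega m k c = + (m * k) - + crossing c

{-# OPTIONS --safe #-}
module Submission where

-- The (m+1)-components refine the m-components, because two overlapping m-tree-connected sets have an
-- m-tree-connected union.  Contract the (m+1)-components.  If some remaining edge could not be added to a
-- family of m+1 disjoint forests, then exchanging edges along fundamental cycles (the argument behind the
-- Nash-Williams–Tutte theorem) would produce a set of at least two vertices spanned by every forest; its
-- preimage would contradict the maximality of the components.  So the edges between (m+1)-components split
-- into m+1 forests, and those of them inside m-components number at most (m+1)(k′ − k).
--
-- The tree-packing data are not decidable; the argument runs under a double negation, which is harmless
-- since the inequality to be proved is decidable.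

open import Defs
open import Data.Nat using (ℕ; zero; suc; _+_; _*_; _≤_; z≤n; s≤s)
import Data.Nat.Properties as ℕ
open import Data.Fin using (Fin; zero; suc; punchOut; inject₁)
import Data.Fin as Fin
open import Data.Fin.Properties using (punchOut-injective; injective⇒≤; inject₁-injective; sequence)
import Data.Fin.Properties as Fin
open import Data.Integer using (+_)
import Data.Integer as ℤ
import Data.Integer.Properties as ℤ
open import Data.Integer.Solver using (module +-*-Solver)
open +-*-Solver using (solve; _:+_; _:*_; _:-_; _:=_)
open import Data.Product using (Σ; ∃; _×_; _,_; proj₁; proj₂)
open import Data.Sum using (_⊎_; inj₁; inj₂)
import Data.Sum as Sum
open import Data.Empty using (⊥)
open import Data.List using (List; []; _∷_; length; filter; allFin)
open import Data.List.Relation.Unary.Any using (here; there)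
open import Data.List.Relation.Unary.All using (lookup; universal)
open import Data.List.Properties using (filter-none)
open import Algebra.Properties.CommutativeSemigroup ℕ.+-commutativeSemigroup using (interchange)
open import Algebra.Properties.CommutativeSemigroup ℕ.*-commutativeSemigroup using (x∙yz≈y∙xz)
open import Data.List.Relation.Unary.AllPairs using (_∷_)
open import Data.List.Relation.Unary.Unique.Propositional using (Unique)
open import Data.List.Relation.Unary.Unique.Propositional.Properties using (allFin⁺)
open import Data.List.Membership.Propositional using (_∈_)
open import Data.List.Membership.Propositional.Properties using (∈-allFin)
open import Data.Vec.Functional using (updateAt)
open import Data.Vec.Functional.Properties using (updateAt-updates; updateAt-minimal)
open import Effect.Monad using (RawMonad)
open import Function using (_∘_; id; const)
open import Relation.Nullary using (¬_; Dec; yes; no; contradiction; map′)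
open import Relation.Nullary.Decidable using (¬?; _×-dec_; _⊎-dec_; decidable-stable; ¬¬-excluded-middle)
open import Relation.Nullary.Negation using (¬¬-Monad)
open import Relation.Unary using (Decidable; _⊆_)
open import Relation.Binary using (DecidableEquality; IsEquivalence)
open import Relation.Binary.PropositionalEquality
import Relation.Binary.Construct.On as On
open import Relation.Binary.Construct.Closure.Equivalence as Eq using (EqClosure)
open import Relation.Binary.Construct.Closure.ReflexiveTransitive using (ε; _◅_; _◅◅_)
open import Relation.Binary.Construct.Closure.Symmetric using (fwd; bwd)

-- Subsets of a finite edge set.

module _ {N : ℕ} where

  infixl 6 _∖_ _∪｛_｝

  _∖_ : (Fin N → Set) → Fin N → Fin N → Set
  (T ∖ e) f = T f × f ≢ e

  _∪｛_｝ : (Fin N → Set) → Fin N → Fin N → Set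
  (T ∪｛ e ｝) f = T f ⊎ f ≡ e

  _∈?_ : (e : Fin N) (L : List (Fin N)) → Dec (e ∈ L)
  _∈?_ = DecM._∈?_
    where import Data.List.Membership.DecPropositional (Fin._≟_ {N}) as DecM

-- Connectivity and forests in multigraphs, with loops so that contractions are included.

module Multigraph {V : Set} {N : ℕ} (p q : Fin N → V) where

  Link : (Fin N → Set) → V → V → Set
  Link T u v = Σ (Fin N) λ e → T e × p e ≡ u × q e ≡ v

  -- An equivalence closure instead of a path type: claims about connected pairs reduce, by
  -- `conn-fold`, to an equivalence relation checked on single edges.
  Conn : (Fin N → Set) → V → V → Set
  Conn T = EqClosure (Link T)

  Acyclic : (Fin N → Set) → Set
  Acyclic T = ∀ e → T e → ¬ Conn (T ∖ e) (p e) (q e)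

  private variable
    S T : Fin N → Set
    u v x y : V
    e : Fin N

  conn-sym : Conn T u v → Conn T v u
  conn-sym {T} = Eq.symmetric (Link T)

  conn-edge : T e → Conn T (p e) (q e)
  conn-edge t = Eq.return (_ , t , refl , refl)

  conn-fold : {R : V → V → Set} → IsEquivalence R →
              (∀ e → T e → R (p e) (q e)) → Conn T u v → R u v
  conn-fold R-equiv h = Eq.fold R-equiv λ { (e , t , refl , refl) → h e t }

  conn-bind : (∀ e → S e → Conn T (p e) (q e)) → Conn S u v → Conn T u v
  conn-bind {T = T} = conn-fold (Eq.isEquivalence (Link T))

  conn-mono : S ⊆ T → Conn S u v → Conn T u v
  conn-mono S⊆T = conn-bind λ e s → conn-edge (S⊆T s)

  -- No edge of `T` leaves or enters `U`, so a walk starting in `U` stays there. The folded relation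
  -- is symmetrised to make it an equivalence.
  conn-within : {U : V → Set} → (∀ e → T e → U (p e) → U (q e)) → (∀ e → T e → U (q e) → U (p e)) →
                U u → Conn T u v → Conn (λ e → T e × U (p e) × U (q e)) u v
  conn-within {T = T} {U = U} U⁺ U⁻ Uu c = proj₂ (proj₁ (conn-fold R-equiv edge c) Uu)
    where
    W = λ e → T e × U (p e) × U (q e)
    R⁺ = λ u v → U u → U v × Conn W u v
    R = λ u v → R⁺ u v × R⁺ v u
    R⁺-trans : ∀ {a b c} → R⁺ a b → R⁺ b c → R⁺ a c
    R⁺-trans f g Ua with f Ua
    ... | Ub , ab with g Ub
    ... | Uc , bc = Uc , ab ◅◅ bc
    R-equiv : IsEquivalence R
    R-equiv = record
      { refl  = (λ Ua → Ua , ε) , (λ Ua → Ua , ε)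
      ; sym   = λ (f , g) → g , f
      ; trans = λ (f , f′) (g , g′) → R⁺-trans f g , R⁺-trans g′ f′
      }
    edge : ∀ e → T e → R (p e) (q e)
    edge e t = (λ Up → let Uq = U⁺ e t Up in Uq , conn-edge (t , Up , Uq))
             , (λ Uq → let Up = U⁻ e t Uq in Up , conn-sym (conn-edge (t , Up , Uq)))

  Meets : (Fin N → Set) → Fin N → V → Set
  Meets T e u = Conn T u (p e) ⊎ Conn T u (q e)

  meets-resp : Conn T u v → Meets T e v → Meets T e u
  meets-resp uv = Sum.map (uv ◅◅_) (uv ◅◅_)

  -- The right-hand side is itself an equivalence containing every edge of `T ∪｛ e ｝`: inserting `e`
  -- only merges the classes of its two ends.
  conn-insert⁻ : Conn (T ∪｛ e ｝) u v → Conn T u v ⊎ (Meets T e u × Meets T e v)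
  conn-insert⁻ {T = T} {e = e} = conn-fold R-equiv edge
    where
    R = λ u v → Conn T u v ⊎ (Meets T e u × Meets T e v)
    R-trans : ∀ {a b c} → R a b → R b c → R a c
    R-trans (inj₁ ab)      (inj₁ bc)      = inj₁ (ab ◅◅ bc)
    R-trans (inj₁ ab)      (inj₂ (b , c)) = inj₂ (meets-resp ab b , c)
    R-trans (inj₂ (a , b)) (inj₁ bc)      = inj₂ (a , meets-resp (conn-sym bc) b)
    R-trans (inj₂ (a , _)) (inj₂ (_ , c)) = inj₂ (a , c)
    R-equiv : IsEquivalence R
    R-equiv = record
      { refl  = inj₁ ε
      ; sym   = Sum.map conn-sym (λ (a , b) → b , a)
      ; trans = R-trans
      }
    edge : ∀ f → (T ∪｛ e ｝) f → R (p f) (q f)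
    edge f (inj₁ t)    = inj₁ (conn-edge t)
    edge f (inj₂ refl) = inj₂ (inj₁ ε , inj₂ ε)

  conn-insert⁺ : Conn T u v ⊎ (Meets T e u × Meets T e v) → Conn (T ∪｛ e ｝) u v
  conn-insert⁺ (inj₁ uv) = conn-mono inj₁ uv
  conn-insert⁺ {T = T} {e = e} (inj₂ (u , v)) = toP u ◅◅ conn-sym (toP v)
    where
    toP : Meets T e x → Conn (T ∪｛ e ｝) x (p e)
    toP (inj₁ xp) = conn-mono inj₁ xp
    toP (inj₂ xq) = conn-mono inj₁ xq ◅◅ conn-sym (conn-edge (inj₂ refl))

  acyclic-⊆ : S ⊆ T → Acyclic T → Acyclic S
  acyclic-⊆ S⊆T acyc e s = acyc e (S⊆T s) ∘ conn-mono λ (s , ne) → S⊆T s , ne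

  -- A new cycle through an old edge `f` must use `e`; going round it the other way, through `f`,
  -- would join the ends of `e` inside `T`.
  acyclic-insert : Acyclic T → ¬ Conn T (p e) (q e) → Acyclic (T ∪｛ e ｝)
  acyclic-insert acyc ¬pq f (inj₂ refl) =
    ¬pq ∘ conn-mono λ { (inj₁ t , _) → t ; (inj₂ f≡e , f≢e) → contradiction f≡e f≢e }
  acyclic-insert {T = T} {e = e} acyc ¬pq f (inj₁ t) c
    with conn-insert⁻ {T = T ∖ f} {e = e} (conn-mono (λ { (inj₁ t , ne) → inj₁ (t , ne) ; (inj₂ eq , _) → inj₂ eq }) c)
  ... | inj₁ c′ = acyc f t c′
  ... | inj₂ (inj₁ a , inj₁ b) = acyc f t (a ◅◅ conn-sym b)
  ... | inj₂ (inj₂ a , inj₂ b) = acyc f t (a ◅◅ conn-sym b)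
  ... | inj₂ (inj₁ a , inj₂ b) = ¬pq (conn-sym (conn-mono proj₁ a) ◅◅ conn-edge t ◅◅ conn-mono proj₁ b)
  ... | inj₂ (inj₂ a , inj₁ b) = ¬pq (conn-sym (conn-mono proj₁ b) ◅◅ conn-sym (conn-edge t) ◅◅ conn-mono proj₁ a)

  -- In a forest, the edges whose removal separates `x` from `y` are those of the unique path
  -- between them. All other edges are pruned one at a time.
  forest-path-edges : Decidable T → (∀ f → Dec (Conn (T ∖ f) x y)) → Acyclic T → Conn T x y →
                      Conn (λ f → T f × ¬ Conn (T ∖ f) x y) x y
  forest-path-edges {T = T} {x = x} {y = y} T? conn? acyc xy =
    conn-mono (λ (t , h) → t , h (∈-allFin _)) (prune (allFin N))
    where
    Kept : List (Fin N) → Fin N → Set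
    Kept L f = T f × (f ∈ L → ¬ Conn (T ∖ f) x y)
    drop : ∀ {e L} → (Kept L ∖ e) ⊆ Kept (e ∷ L)
    drop ((t , h) , ne) = t , λ { (here f≡e) → contradiction f≡e ne ; (there i) → h i }
    shrink : ∀ {e L} → Conn (Kept L ∖ e) u v → Conn (T ∖ e) u v
    shrink = conn-mono λ ((t , _) , ne) → t , ne
    prune : ∀ L → Conn (Kept L) x y
    prune [] = conn-mono (λ t → t , λ ()) xy
    prune (e ∷ L) with T? e | conn? e
    ... | no ¬t | _ = conn-mono (λ (t , h) → drop ((t , h) , λ { refl → ¬t t })) (prune L)
    ... | yes _ | no ¬c =
      conn-mono (λ (t , h) → t , λ { (here refl) → ¬c ; (there i) → h i }) (prune L)
    ... | yes t | yes c with conn-insert⁻ {T = Kept L ∖ e} {e = e} (conn-mono split (prune L))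
      where
      split : Kept L ⊆ (Kept L ∖ e) ∪｛ e ｝
      split {f} k with f Fin.≟ e
      ... | yes f≡e = inj₂ f≡e
      ... | no  f≢e = inj₁ (k , f≢e)
    ... | inj₁ xy′ = conn-mono drop xy′
    ... | inj₂ (inj₁ a , inj₁ b) = conn-mono drop (a ◅◅ conn-sym b)
    ... | inj₂ (inj₂ a , inj₂ b) = conn-mono drop (a ◅◅ conn-sym b)
    -- The walk from `p e` to `x`, on to `y` by `c`, and then to `q e` avoids `e`, so `e` would lie
    -- on a cycle.
    ... | inj₂ (inj₁ a , inj₂ b) = contradiction (conn-sym (shrink {L = L} a) ◅◅ c ◅◅ shrink {L = L} b) (acyc e t)
    ... | inj₂ (inj₂ a , inj₁ b) = contradiction (conn-sym (shrink {L = L} b) ◅◅ conn-sym c ◅◅ shrink {L = L} a) (acyc e t)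

  module _ (_≟_ : DecidableEquality V) where

    conn? : Decidable T → ∀ u v → Dec (Conn T u v)
    conn? {T = T} T? u v =
      map′ (conn-mono proj₁) (conn-mono λ t → t , ∈-allFin _) (go (allFin N) u v)
      where
      go : ∀ L u v → Dec (Conn (λ f → T f × f ∈ L) u v)
      go [] u v = map′ (λ { refl → ε }) (conn-fold isEquivalence λ _ ()) (u ≟ v)
      go (e ∷ L) u v with T? e
      ... | no ¬t = map′ (conn-mono λ (t , i) → t , there i)
                         (conn-mono λ { (t , here refl) → contradiction t ¬t ; (t , there i) → t , i })
                         (go L u v)
      ... | yes t = map′ (conn-mono (λ { (inj₁ (t , i)) → t , there i ; (inj₂ refl) → t , here refl }) ∘ conn-insert⁺)
                         (conn-insert⁻ ∘ conn-mono λ { (t , here eq) → inj₂ eq ; (t , there i) → inj₁ (t , i) })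
                         (go L u v ⊎-dec (meets? u ×-dec meets? v))
        where
        meets? : ∀ u → Dec (Meets (λ f → T f × f ∈ L) e u)
        meets? u = go L u (p e) ⊎-dec go L u (q e)

    -- Greedy choice: an edge of `S` is taken when its ends are not yet connected.
    spanning-forest : Decidable S → Σ (Fin N → Set) λ T →
                      Decidable T × T ⊆ S × Acyclic T × (∀ e → S e → Conn T (p e) (q e))
    spanning-forest {S = S} S? with go (allFin N)
      where
      go : ∀ L → Σ (Fin N → Set) λ T →
           Decidable T × T ⊆ S × Acyclic T × (∀ e → e ∈ L → S e → Conn T (p e) (q e))
      go [] = const ⊥ , (λ _ → no λ ()) , (λ ()) , (λ _ ()) , λ _ ()
      go (e ∷ L) with go L
      ... | T , T? , T⊆S , acyc , span with conn? T? (p e) (q e) | S? e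
      ...   | yes c | _ =
        T , T? , T⊆S , acyc , λ { _ (here refl) _ → c ; f (there i) → span f i }
      ...   | no ¬c | no ¬s =
        T , T? , T⊆S , acyc , λ { _ (here refl) s → contradiction s ¬s ; f (there i) → span f i }
      ...   | no ¬c | yes s =
        T ∪｛ e ｝ , (λ f → T? f ⊎-dec f Fin.≟ e) , (λ { (inj₁ t) → T⊆S t ; (inj₂ refl) → s }) ,
        acyclic-insert acyc ¬c ,
        λ { _ (here refl) _ → conn-edge (inj₂ refl) ; f (there i) s → conn-mono inj₁ (span f i s) }
    ... | T , T? , T⊆S , acyc , span = T , T? , T⊆S , acyc , λ e → span e (∈-allFin e)

  -- Exchanging edges between disjoint forests, encoded as colour classes.

  Class : {M : ℕ} → (Fin N → Set) → (Fin N → Fin M) → Fin M → Fin N → Set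
  Class A col j f = A f × col f ≡ j

  module Exchange (_≟_ : DecidableEquality V) {M : ℕ} {A : Fin N → Set} (A? : Decidable A)
                  (col₀ : Fin N → Fin M) (e₀ : Fin N)
                  (acyc₀ : ∀ j → Acyclic (Class (A ∖ e₀) col₀ j))
                  (maximal : ¬ ∃ λ (col : Fin N → Fin M) → ∀ j → Acyclic (Class A col j)) where

    Forest : (Fin N → Fin M) → Fin N → Fin M → Fin N → Set
    Forest col e = Class (A ∖ e) col

    recolour : (Fin N → Fin M) → Fin N → Fin M → Fin N → Fin M
    recolour col e i = updateAt col e (const i)

    -- Hole col e: exchanges starting from col₀ lead to the forests given by col, in which
    -- e is the only edge of A left uncovered.  (The value col e is junk.)
    data Hole : (Fin N → Fin M) → Fin N → Set where
      start : Hole col₀ e₀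
      move  : ∀ {col e} → Hole col e → ∀ i e′ → Forest col e i e′ →
              ¬ Conn (Forest col e i ∖ e′) (p e) (q e) → Hole (recolour col e i) e′

    -- The edges that some sequence of exchanges can leave uncovered.
    E⁰ : Fin N → Set
    E⁰ e = ∃ λ col → Hole col e

    forest? : ∀ col e j → Decidable (Forest col e j)
    forest? col e j f = (A? f ×-dec ¬? (f Fin.≟ e)) ×-dec col f Fin.≟ j

    recolour-class : ∀ {col e i j f} → A f → recolour col e i f ≡ j →
                     Forest col e j f ⊎ (j ≡ i × f ≡ e)
    recolour-class {col} {e} {i} {j} {f} a eq with f Fin.≟ e
    ... | yes refl = inj₂ (trans (sym eq) (updateAt-updates e col) , refl)
    ... | no  f≢e  = inj₁ ((a , f≢e) , trans (sym (updateAt-minimal f e col f≢e)) eq)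

    -- Only class `i` gains an edge, namely `e`. `B` is `A ∖ e′` after an exchange, and all of `A`
    -- when a full colouring is to contradict `maximal`.
    recolour-acyclic : ∀ {B col e i} → (∀ j → Acyclic (Forest col e j)) →
                       B ⊆ A → ¬ Conn (λ f → Forest col e i f × B f) (p e) (q e) →
                       ∀ j → Acyclic (Class B (recolour col e i) j)
    recolour-acyclic {B} {col} {e} {i} acyc B⊆A ¬c j with j Fin.≟ i
    ... | yes refl = acyclic-⊆ (λ (b , eq) → Sum.map (_, b) proj₂ (recolour-class (B⊆A b) eq))
                               (acyclic-insert (acyclic-⊆ proj₁ (acyc i)) ¬c)
    ... | no  j≢i = acyclic-⊆ (λ (b , eq) → Sum.[ id , (λ (j≡i , _) → contradiction j≡i j≢i) ]
                                              (recolour-class (B⊆A b) eq))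
                              (acyc j)

    hole-acyclic : ∀ {col e} → Hole col e → ∀ j → Acyclic (Forest col e j)
    hole-acyclic start = acyc₀
    hole-acyclic (move h i e′ _ bridge) =
      recolour-acyclic (hole-acyclic h) proj₁ (bridge ∘ conn-mono λ (t , _ , ne) → t , ne)

    -- If forest `i` did not join the ends of `e`, it could absorb `e`, against `maximal`. So it
    -- contains a path between them, and each edge of that path can be exchanged for `e`, hence lies
    -- in `E⁰`.
    hole-conn : ∀ {col e} → Hole col e → ∀ i → Conn (λ f → Forest col e i f × E⁰ f) (p e) (q e)
    hole-conn {col} {e} h i with conn? _≟_ (forest? col e i) (p e) (q e)
    ... | no ¬c = contradiction
      (recolour col e i , recolour-acyclic (hole-acyclic h) id (¬c ∘ conn-mono proj₁)) maximal
    ... | yes c = conn-mono (λ (t , bridge) → t , _ , move h i _ t bridge)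
      (forest-path-edges (forest? col e i)
        (λ e′ → conn? _≟_ (λ f → forest? col e i f ×-dec ¬? (f Fin.≟ e′)) (p e) (q e))
        (hole-acyclic h i) c)

    -- An exchange puts e into class i; hole-conn bypasses e inside the previous class i.
    conn-undo : ∀ {col e u v} → Hole col e → ∀ j →
                Conn (λ f → Forest col e j f × E⁰ f) u v → Conn (λ f → Forest col₀ e₀ j f × E⁰ f) u v
    conn-undo start j c = c
    conn-undo (move {col} {e} h i e′ _ _) j c = conn-undo h j (conn-bind undo c)
      where
      undo : ∀ f → Forest (recolour col e i) e′ j f × E⁰ f →
             Conn (λ f → Forest col e j f × E⁰ f) (p f) (q f)
      undo f (((a , _) , eq) , f⁰) with recolour-class a eq
      ... | inj₁ t             = conn-edge (t , f⁰)
      ... | inj₂ (refl , refl) = hole-conn h i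

    Region : V → Set
    Region = Conn E⁰ (p e₀)

    region-end : Region (q e₀)
    region-end = conn-edge (col₀ , start)

    -- Each edge of `E⁰` is bypassed in forest `j` at the state where it is the hole, and
    -- `conn-undo` carries the bypass back to `col₀`. Edges of `E⁰` never leave the region.
    region-spanned : ∀ j {u v} → Region u → Region v →
                     Conn (λ f → Class A col₀ j f × Region (p f) × Region (q f)) u v
    region-spanned j u v =
      conn-mono (λ ((((a , _) , eq) , _) , r) → (a , eq) , r)
        (conn-within (λ f (_ , f⁰) pf → pf ◅◅ conn-edge f⁰)
                     (λ f (_ , f⁰) qf → qf ◅◅ conn-sym (conn-edge f⁰))
                     u (conn-bind (λ { f (_ , h) → conn-undo h j (hole-conn h j) }) (conn-sym u ◅◅ v)))

  -- The edges of `P` are coloured one at a time; an edge that admits no extension, even after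
  -- recolouring the others, yields a region that `stuck` forbids.
  forest-cover : (_≟_ : DecidableEquality V) {m : ℕ} {P : Fin N → Set} → Decidable P →
                 (∀ e → P e → (col : Fin N → Fin (suc m)) (U : V → Set) → U (p e) → U (q e) →
                  (∀ j {u v} → U u → U v → Conn (λ f → Class P col j f × U (p f) × U (q f)) u v) → ⊥) →
                 ¬ ¬ ∃ λ (col : Fin N → Fin (suc m)) → ∀ j → Acyclic (Class P col j)
  forest-cover _≟_ {m} {P} P? stuck none =
    cover (allFin N) λ (col , acyc) → none (col , λ j → acyclic-⊆ (λ (t , eq) → (t , ∈-allFin _) , eq) (acyc j))
    where
    cover : ∀ L → ¬ ¬ ∃ λ (col : Fin N → Fin (suc m)) → ∀ j → Acyclic (Class (λ f → P f × f ∈ L) col j)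
    -- Some colour must exist even before any edge is covered, hence `suc m` colours.
    cover [] none = none (const zero , λ { _ _ ((_ , ()) , _) })
    cover (e ∷ L) none = cover L extend
      where
      extend : ¬ ∃ λ col → ∀ j → Acyclic (Class (λ f → P f × f ∈ L) col j)
      extend (col , acyc) with P? e
      ... | no ¬t = none (col , λ j → acyclic-⊆
        (λ { ((t , here refl) , _) → contradiction t ¬t ; ((t , there i) , eq) → (t , i) , eq }) (acyc j))
      ... | yes t = stuck e t col Region ε region-end λ j u v →
        conn-mono (λ (((t′ , _) , eq) , r) → (t′ , eq) , r) (region-spanned j u v)
        where
        hole-at-e : ∀ j → Acyclic (Class ((λ f → P f × f ∈ e ∷ L) ∖ e) col j)
        hole-at-e j = acyclic-⊆ (λ { (((_ , here f≡e) , f≢e) , _) → contradiction f≡e f≢e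
                                   ; (((t′ , there i) , _) , eq) → (t′ , i) , eq }) (acyc j)
        open Exchange _≟_ (λ f → P? f ×-dec (f ∈? (e ∷ L))) col e hole-at-e none

-- Counting the edges of a forest.

module _ {s : ℕ} {i j : Fin (suc s)} (i≢j : i ≢ j) where

  glue : Fin (suc s) → Fin s
  glue x with i Fin.≟ x
  ... | yes _   = punchOut i≢j
  ... | no  i≢x = punchOut i≢x

  glue-injective : ∀ x y → glue x ≡ glue y → x ≡ y ⊎ (x ≡ j ⊎ x ≡ i) × (y ≡ j ⊎ y ≡ i)
  glue-injective x y eq with i Fin.≟ x | i Fin.≟ y
  ... | yes i≡x | yes i≡y = inj₂ (inj₂ (sym i≡x) , inj₂ (sym i≡y))
  ... | yes i≡x | no  i≢y = inj₂ (inj₂ (sym i≡x) , inj₁ (sym (punchOut-injective i≢j i≢y eq)))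
  ... | no  i≢x | yes i≡y = inj₂ (inj₁ (punchOut-injective i≢x i≢j eq) , inj₂ (sym i≡y))
  ... | no  i≢x | no  i≢y = inj₁ (punchOut-injective i≢x i≢y eq)

module _ {N r : ℕ} (p q : Fin N → Fin r) {T : Fin N → Set} (T? : Decidable T) where

  open Multigraph p q

  -- `g` labels components; each edge of the forest merges two of them and lowers `s` by one. That
  -- equal labels imply connection is enough for acyclicity to separate the ends of the next edge.
  forest-components : Acyclic T → ∀ L → Unique L → Σ ℕ λ s → Σ (Fin r → Fin s) λ g →
                      (∀ u v → g u ≡ g v → Conn (λ f → T f × f ∈ L) u v) × length (filter T? L) + s ≡ r
  forest-components acyc [] _ = r , id , (λ { _ _ refl → ε }) , refl
  forest-components acyc (e ∷ L) (e∉L ∷ uniq) with T? e | forest-components acyc L uniq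
  ... | no _ | s , g , sound , count = s , g , (λ u v → conn-mono (λ (t , i) → t , there i) ∘ sound u v) , count
  ... | yes t | zero , g , _ = contradiction (g (p e)) λ ()
  ... | yes t | suc s , g , sound , count =
    s , glue gq≢gp ∘ g , (λ u v → conn-mono widen ∘ conn-insert⁺ ∘ merged u v) , trans (sym (ℕ.+-suc _ s)) count
    where
    Rest : Fin N → Set
    Rest f = T f × f ∈ L
    -- Equal labels would connect the ends of `e` by edges of `L`, and uniqueness of the list keeps
    -- `e` itself out of `L`.
    gq≢gp : g (q e) ≢ g (p e)
    gq≢gp eq = acyc e t (conn-mono (λ (t′ , i) → t′ , λ { refl → lookup e∉L i refl }) (sound _ _ (sym eq)))
    widen : Rest ∪｛ e ｝ ⊆ (λ f → T f × f ∈ e ∷ L)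
    widen (inj₁ (t′ , i)) = t′ , there i
    widen (inj₂ refl)     = t , here refl
    merged : ∀ u v → glue gq≢gp (g u) ≡ glue gq≢gp (g v) → Conn Rest u v ⊎ Meets Rest e u × Meets Rest e v
    merged u v eq = Sum.map (sound u v)
      (λ (a , b) → Sum.map (sound u _) (sound u _) a , Sum.map (sound v _) (sound v _) b)
      (glue-injective gq≢gp (g u) (g v) eq)

  -- `f` is constant on each of the `s` components, so its `k` values force `k ≤ s`.
  forest-size : ∀ {k} → Acyclic T → (f : Fin r → Fin k) → (∀ i → ∃ λ v → f v ≡ i) →
                (∀ e → T e → f (p e) ≡ f (q e)) → length (filter T? (allFin N)) + k ≤ r
  forest-size acyc f surj const-on with forest-components acyc (allFin N) (allFin⁺ N)
  ... | s , g , sound , count =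
    subst (_ ≤_) count (ℕ.+-monoʳ-≤ (length (filter T? (allFin N))) (injective⇒≤ injective))
    where
    injective : ∀ {i j} → g (proj₁ (surj i)) ≡ g (proj₁ (surj j)) → i ≡ j
    injective {i} {j} eq = trans (sym (proj₂ (surj i)))
      (trans (conn-fold (On.isEquivalence f isEquivalence) (λ e (t , _) → const-on e t) (sound _ _ eq)) (proj₂ (surj j)))

-- Double negation over finite types, and counting in lists.

¬¬-∀ : ∀ {n} {P : Fin n → Set} → (∀ i → ¬ ¬ P i) → ¬ ¬ (∀ i → P i)
¬¬-∀ = sequence (RawMonad.rawApplicative ¬¬-Monad)

¬¬-decidable : ∀ {n} (P : Fin n → Set) → ¬ ¬ Decidable P
¬¬-decidable P = ¬¬-∀ λ i → ¬¬-excluded-middle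

module _ {A : Set} where

  count-⊎ : {P Q R : A → Set} (P? : Decidable P) (Q? : Decidable Q) (R? : Decidable R) →
            (∀ x → P x → Q x ⊎ R x) → ∀ xs →
            length (filter P? xs) ≤ length (filter Q? xs) + length (filter R? xs)
  count-⊎ P? Q? R? h [] = z≤n
  count-⊎ P? Q? R? h (x ∷ xs) with ih ← count-⊎ P? Q? R? h xs | P? x | Q? x | R? x
  ... | no _  | no _  | no _  = ih
  ... | no _  | yes _ | no _  = ℕ.m≤n⇒m≤1+n ih
  ... | no _  | no _  | yes _ = ℕ.≤-trans ih (ℕ.+-monoʳ-≤ _ (ℕ.n≤1+n _))
  ... | no _  | yes _ | yes _ = ℕ.m≤n⇒m≤1+n (ℕ.≤-trans ih (ℕ.+-monoʳ-≤ _ (ℕ.n≤1+n _)))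
  ... | yes _ | yes _ | no _  = s≤s ih
  ... | yes _ | yes _ | yes _ = s≤s (ℕ.≤-trans ih (ℕ.+-monoʳ-≤ _ (ℕ.n≤1+n _)))
  ... | yes _ | no _  | yes _ = ℕ.≤-trans (s≤s ih) (ℕ.≤-reflexive (sym (ℕ.+-suc _ _)))
  ... | yes t | no ¬q | no ¬r = contradiction (h x t) Sum.[ ¬q , ¬r ]

  -- A union bound over the `M` classes; `k` stands on the left to avoid truncated subtraction.
  count-⋃ : ∀ {k r} (xs : List A) {M} {P : A → Set} {Q : Fin M → A → Set}
            (P? : Decidable P) (Q? : ∀ j → Decidable (Q j)) → (∀ x → P x → ∃ λ j → Q j x) →
            (∀ j → length (filter (Q? j) xs) + k ≤ r) → length (filter P? xs) + M * k ≤ M * r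
  count-⋃ xs {zero} P? Q? h bound =
    ℕ.≤-reflexive (trans (ℕ.+-identityʳ _)
      (cong length (filter-none P? (universal (λ x t → Fin.¬Fin0 (proj₁ (h x t))) xs))))
  count-⋃ {k} {r} xs {suc M} {P} {Q} P? Q? h bound = begin
    #P + (k + M * k)          ≤⟨ ℕ.+-monoˡ-≤ (k + M * k) (count-⊎ P? (Q? zero) R? split xs) ⟩
    (#Q + #R) + (k + M * k)   ≡⟨ interchange #Q #R k (M * k) ⟩
    (#Q + k) + (#R + M * k)   ≤⟨ ℕ.+-mono-≤ (bound zero) (count-⋃ xs R? (Q? ∘ suc) (λ _ → id) (bound ∘ suc)) ⟩
    r + M * r                 ∎
    where
    open ℕ.≤-Reasoning
    R? : Decidable (λ x → ∃ λ j → Q (suc j) x)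
    R? x = Fin.any? λ j → Q? (suc j) x
    split : ∀ x → P x → Q zero x ⊎ ∃ λ j → Q (suc j) x
    split x t with h x t
    ... | zero  , y = inj₁ y
    ... | suc j , y = inj₂ (j , y)
    #P = length (filter P? xs)
    #Q = length (filter (Q? zero) xs)
    #R = length (filter R? xs)

-- Tree-connected vertex sets.

module _ (G : Graph) where

  private
    p q : Fin (ne G) → Fin (n G)
    p = proj₁ ∘ ends G
    q = proj₂ ∘ ends G

  open Multigraph p q

  private variable
    T : Fin (ne G) → Set
    u v : Fin (n G)

  reach⇒conn : Reach G T u v → Conn T u v
  reach⇒conn here = ε
  reach⇒conn (step e t (inj₁ eq) r) = Eq.return (e , t , cong proj₁ eq , cong proj₂ eq) ◅◅ reach⇒conn r
  reach⇒conn (step e t (inj₂ eq) r) = conn-sym (Eq.return (e , t , cong proj₁ eq , cong proj₂ eq)) ◅◅ reach⇒conn r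

  conn⇒reach : Conn T u v → Reach G T u v
  conn⇒reach ε = here
  conn⇒reach (fwd (e , t , refl , refl) ◅ c) = step e t (inj₁ refl) (conn⇒reach c)
  conn⇒reach (bwd (e , t , refl , refl) ◅ c) = step e t (inj₂ refl) (conn⇒reach c)

  -- A spanning forest of each `C i` is already a spanning tree of `S`, so later constructions need
  -- not care about cycles.
  treeConnected : ∀ {m} {S : Fin (n G) → Set} {C : Fin m → Fin (ne G) → Set} → (∀ i → Decidable (C i)) →
                  (∀ i e → C i e → S (p e) × S (q e)) → (∀ i u v → S u → S v → Conn (C i) u v) →
                  (∀ i j e → C i e → C j e → i ≡ j) → TreeConnected G m S
  treeConnected {m} {S} {C} C? inside spans disjoint =
    (λ i → proj₁ (forest i)) , tree ,
    λ i j e t t′ → disjoint i j e (proj₁ (proj₂ (proj₂ (forest i))) t) (proj₁ (proj₂ (proj₂ (forest j))) t′)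
    where
    forest = λ i → spanning-forest Fin._≟_ (C? i)
    tree : ∀ i → IsSpanningTree G S (proj₁ (forest i))
    tree i = let _ , _ , T⊆C , acyc , span = forest i in
      (λ e → inside i e ∘ T⊆C) , (λ u v Su Sv → conn⇒reach (conn-bind span (spans i u v Su Sv))) ,
      λ e t → acyc e t ∘ reach⇒conn

  treeConnected-pred : ∀ {m} {S : Fin (n G) → Set} → TreeConnected G (suc m) S → TreeConnected G m S
  treeConnected-pred (Ts , tree , disjoint) =
    Ts ∘ inject₁ , tree ∘ inject₁ , λ i j e t t′ → inject₁-injective (disjoint _ _ e t t′)

  -- Each tree on `X` is joined with the edges of a tree on `Y` that do not lie inside `X`; dropped
  -- edges are bypassed in the tree on `X`. Disjointness holds because trees on `X` lie inside `X`.
  treeConnected-∪ : ∀ {m w} {X Y : Fin (n G) → Set} → Decidable X → X w → Y w →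
                    TreeConnected G m X → TreeConnected G m Y → ¬ ¬ TreeConnected G m (λ v → X v ⊎ Y v)
  treeConnected-∪ {m} {w} {X} {Y} X? Xw Yw (Ts , tree , disjoint) (Ts′ , tree′ , disjoint′) none =
    ¬¬-∀ (λ i → ¬¬-decidable (Ts i)) λ Ts? →
    ¬¬-∀ (λ i → ¬¬-decidable (Ts′ i)) λ Ts′? →
    none (treeConnected (λ i e → Ts? i e ⊎-dec (Ts′? i e ×-dec ¬? (X? (p e) ×-dec X? (q e))))
                        inside (λ i u v a b → conn-sym (fromW i a) ◅◅ fromW i b) disjoint-∪)
    where
    C : Fin m → Fin (ne G) → Set
    C i e = Ts i e ⊎ (Ts′ i e × ¬ (X (p e) × X (q e)))
    inside : ∀ i e → C i e → (X (p e) ⊎ Y (p e)) × (X (q e) ⊎ Y (q e))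
    inside i e (inj₁ t)       = let a , b = proj₁ (tree i) e t in inj₁ a , inj₁ b
    inside i e (inj₂ (t , _)) = let a , b = proj₁ (tree′ i) e t in inj₂ a , inj₂ b
    spanX : ∀ i {u v} → X u → X v → Conn (C i) u v
    spanX i Xu Xv = conn-mono inj₁ (reach⇒conn (proj₁ (proj₂ (tree i)) _ _ Xu Xv))
    reroute : ∀ i e → Ts′ i e → Conn (C i) (p e) (q e)
    reroute i e t with X? (p e) ×-dec X? (q e)
    ... | yes (a , b) = spanX i a b
    ... | no  ¬inX    = conn-edge (inj₂ (t , ¬inX))
    fromW : ∀ i {v} → X v ⊎ Y v → Conn (C i) w v
    fromW i (inj₁ Xv) = spanX i Xw Xv
    fromW i (inj₂ Yv) = conn-bind (reroute i) (reach⇒conn (proj₁ (proj₂ (tree′ i)) _ _ Yw Yv))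
    disjoint-∪ : ∀ i j e → C i e → C j e → i ≡ j
    disjoint-∪ i j e (inj₁ t)       (inj₁ t′)       = disjoint i j e t t′
    disjoint-∪ i j e (inj₁ t)       (inj₂ (_ , ¬x)) = contradiction (proj₁ (tree i) e t) ¬x
    disjoint-∪ i j e (inj₂ (_ , ¬x)) (inj₁ t)       = contradiction (proj₁ (tree j) e t) ¬x
    disjoint-∪ i j e (inj₂ (t , _)) (inj₂ (t′ , _)) = disjoint′ i j e t t′

  -- Comparing the two component partitions.

  module _ {m k k′ : ℕ} {c : Fin (n G) → Fin k} {c′ : Fin (n G) → Fin k′} where

    -- The `m`-component of `u` and the `suc m`-component of `v` share `u`, so their union is
    -- `m`-tree-connected, and maximality puts `v` in the former.
    components-refine : IsComponentPartition G m k c → IsComponentPartition G (suc m) k′ c′ →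
                        c′ u ≡ c′ v → c u ≡ c v
    components-refine {u} {v} (_ , comp) (_ , comp′) eq =
      sym (decidable-stable (c v Fin.≟ c u) λ ne →
        treeConnected-∪ (λ w → c w Fin.≟ c u) refl eq (proj₁ (comp (c u)))
          (treeConnected-pred (proj₁ (comp′ (c′ v)))) λ tc →
        ne (proj₂ (comp (c u)) _ (λ _ → inj₁) tc v (inj₂ refl)))

  module _ {m k : ℕ} {c : Fin (n G) → Fin k} (part : IsComponentPartition G m k c) where

    private
      module H = Multigraph (c ∘ p) (c ∘ q)
      Crossing : Fin (ne G) → Set
      Crossing e = c (p e) ≢ c (q e)
      trees = λ x → proj₁ (proj₂ part x)

    -- The preimage of such a region U, with the trees of its parts and the classes of col,
    -- would be m-tree-connected and strictly larger than a component.
    no-spanned-region : ∀ e → Crossing e → (col : Fin (ne G) → Fin m) (U : Fin k → Set) →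
      U (c (p e)) → U (c (q e)) →
      (∀ j {x y} → U x → U y → H.Conn (λ f → H.Class Crossing col j f × U (c (p f)) × U (c (q f))) x y) → ⊥
    no-spanned-region e e-crosses col U Up Uq spanned =
      ¬¬-decidable U λ U? →
      ¬¬-∀ (λ x → ¬¬-∀ λ j → ¬¬-decidable (proj₁ (trees x) j)) λ Ts? →
      -- Maximality would place `q e` in the component of `p e`, although `e` crosses.
      e-crosses (sym (proj₂ (proj₂ part (c (p e))) S (λ v eq → subst U (sym eq) Up)
        (treeConnected
          (λ j f → (Ts? (c (p f)) j f ⊎-dec ((¬? (c (p f) Fin.≟ c (q f)) ×-dec (col f Fin.≟ j))
                      ×-dec (U? (c (p f)) ×-dec U? (c (q f)))))
                   ×-dec (U? (c (p f)) ×-dec U? (c (q f))))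
          (λ j f → proj₂)
          (λ j u v Uu Uv → conn-within (closed j) (closed⁻ j) Uu (lift j (spanned j Uu Uv) u v refl refl))
          disjoint)
        (q e) Uq))
      where
      S : Fin (n G) → Set
      S v = U (c v)
      Tree Joined : Fin m → Fin (ne G) → Set
      -- The part is read off from the end `p f`, which avoids quantifying over parts.
      Tree j f = proj₁ (trees (c (p f))) j f
      Joined j f = Tree j f ⊎ (H.Class Crossing col j f × S (p f) × S (q f))
      tree-inside : ∀ j {x} f → proj₁ (trees x) j f → c (p f) ≡ x × c (q f) ≡ x
      tree-inside j {x} f = proj₁ (proj₁ (proj₂ (trees x)) j) f
      closed : ∀ j f → Joined j f → S (p f) → S (q f)
      closed j f (inj₁ t) Up           = subst U (sym (proj₂ (tree-inside j f t))) Up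
      closed j f (inj₂ (_ , _ , Uq)) _ = Uq
      closed⁻ : ∀ j f → Joined j f → S (q f) → S (p f)
      closed⁻ j f (inj₁ t) Uq           = subst U (proj₂ (tree-inside j f t)) Uq
      closed⁻ j f (inj₂ (_ , Up , _)) _ = Up
      within-part : ∀ j {u v} → c u ≡ c v → Conn (Joined j) u v
      within-part j {u} {v} eq =
        conn-mono (λ {f} t → inj₁ (subst (λ x → proj₁ (trees x) j f) (sym (proj₁ (tree-inside j f t))) t))
          (reach⇒conn (proj₁ (proj₂ (proj₁ (proj₂ (trees (c v))) j)) u v eq refl))
      -- A contracted vertex is expanded to its part, whose own tree joins any two representatives;
      -- transitivity uses that parts are nonempty.
      lift : ∀ j {x y} → H.Conn (λ f → H.Class Crossing col j f × S (p f) × S (q f)) x y →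
             ∀ u v → c u ≡ x → c v ≡ y → Conn (Joined j) u v
      lift j = H.conn-fold
        (record
          { refl  = λ u v a b → within-part j (trans a (sym b))
          ; sym   = λ f u v a b → conn-sym (f v u b a)
          ; trans = λ {_} {y} f g u v a b → let w , d = proj₁ part y in f u w a d ◅◅ g w v d b
          })
        λ f t u v a b → within-part j a ◅◅ conn-edge (inj₂ t) ◅◅ within-part j (sym b)
      disjoint : ∀ i j f → Joined i f × S (p f) × S (q f) → Joined j f × S (p f) × S (q f) → i ≡ j
      disjoint i j f (inj₁ t , _) (inj₁ t′ , _) = proj₂ (proj₂ (trees (c (p f)))) i j f t t′
      disjoint i j f (inj₁ t , _) (inj₂ ((cr , _) , _) , _) = contradiction (sym (proj₂ (tree-inside i f t))) cr
      disjoint i j f (inj₂ ((cr , _) , _) , _) (inj₁ t , _) = contradiction (sym (proj₂ (tree-inside j f t))) cr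
      disjoint i j f (inj₂ ((_ , eq) , _) , _) (inj₂ ((_ , eq′) , _) , _) = trans (sym eq) eq′

  -- The edges crossing `c′` but not `c` split into `suc m` forests on the `k′` contracted vertices.
  -- Each forest stays within the fibres of a surjection onto `Fin k`, so it has at most `k′ - k`
  -- edges.
  crossing-bound : ∀ {m k k′} {c : Fin (n G) → Fin k} {c′ : Fin (n G) → Fin k′} →
                   IsComponentPartition G m k c → IsComponentPartition G (suc m) k′ c′ →
                   crossing G c′ + suc m * k ≤ crossing G c + suc m * k′
  crossing-bound {m} {k} {k′} {c} {c′} part part′ = decidable-stable (_ ℕ.≤? _) λ fails →
    H.forest-cover Fin._≟_ crosses′? (no-spanned-region part′) λ (col , acyc) →
    fails (begin
      crossing G c′ + suc m * k
        ≤⟨ ℕ.+-monoˡ-≤ (suc m * k) (count-⊎ crosses′? crosses? D? split (allFin (ne G))) ⟩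
      (crossing G c + #D) + suc m * k
        ≡⟨ ℕ.+-assoc (crossing G c) #D (suc m * k) ⟩
      crossing G c + (#D + suc m * k)
        ≤⟨ ℕ.+-monoʳ-≤ (crossing G c)
             (count-⋃ (allFin (ne G)) D? (λ j e → D? e ×-dec col e Fin.≟ j) (λ e d → col e , d , refl)
               λ j → forest-size (c′ ∘ p) (c′ ∘ q) _
                       (H.acyclic-⊆ (λ ((cr , _) , eq) → cr , eq) (acyc j)) f f-surj
                       λ { e ((_ , eq) , _) → trans (f-c′ (p e)) (trans eq (sym (f-c′ (q e)))) }) ⟩
      crossing G c + suc m * k′ ∎)
    where
    open ℕ.≤-Reasoning
    module H = Multigraph (c′ ∘ p) (c′ ∘ q)
    crosses? : Decidable (λ e → c (p e) ≢ c (q e))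
    crosses? e = ¬? (c (p e) Fin.≟ c (q e))
    crosses′? : Decidable (λ e → c′ (p e) ≢ c′ (q e))
    crosses′? e = ¬? (c′ (p e) Fin.≟ c′ (q e))
    D? : Decidable (λ e → c′ (p e) ≢ c′ (q e) × c (p e) ≡ c (q e))
    D? e = crosses′? e ×-dec c (p e) Fin.≟ c (q e)
    #D = length (filter D? (allFin (ne G)))
    split : ∀ e → c′ (p e) ≢ c′ (q e) → c (p e) ≢ c (q e) ⊎ (c′ (p e) ≢ c′ (q e) × c (p e) ≡ c (q e))
    split e cr with c (p e) Fin.≟ c (q e)
    ... | yes eq = inj₂ (cr , eq)
    ... | no  ne = inj₁ ne
    -- The coarsening map, defined by representatives; refinement makes their choice immaterial.
    f : Fin k′ → Fin k
    f x = c (proj₁ (proj₁ part′ x))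
    f-c′ : ∀ v → f (c′ v) ≡ c v
    f-c′ v = components-refine part part′ (proj₂ (proj₁ part′ (c′ v)))
    f-surj : ∀ i → ∃ λ x → f x ≡ i
    f-surj i = let v , eq = proj₁ part i in c′ v , trans (f-c′ v) eq

-- Integer arithmetic and the two inequalities.

surjective⇒≤ : ∀ {a b} (f : Fin a → Fin b) → (∀ y → ∃ λ x → f x ≡ y) → b ≤ a
surjective⇒≤ f surj = injective⇒≤ {f = proj₁ ∘ surj} λ {x} {y} eq →
  trans (sym (proj₂ (surj x))) (trans (cong f eq) (proj₂ (surj y)))

a+d≤b+c⇒a-c≤b-d : ∀ a b c d → a + d ≤ b + c → + a ℤ.- + c ℤ.≤ + b ℤ.- + d
a+d≤b+c⇒a-c≤b-d a b c d le = subst₂ ℤ._≤_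
  (solve 3 (λ a c d → (a :+ d) :- (c :+ d) := a :- c) refl (+ a) (+ c) (+ d))
  (solve 3 (λ b c d → (b :+ c) :- (c :+ d) := b :- d) refl (+ b) (+ c) (+ d))
  (ℤ.+-monoˡ-≤ (ℤ.- (+ c ℤ.+ + d)) (ℤ.+≤+ le))

*-distribˡ-⁺- : ∀ a b c → + a ℤ.* (+ b ℤ.- + c) ≡ + (a * b) ℤ.- + (a * c)
*-distribˡ-⁺- a b c = begin
  + a ℤ.* (+ b ℤ.- + c)              ≡⟨ solve 3 (λ a b c → a :* (b :- c) := a :* b :- a :* c) refl (+ a) (+ b) (+ c) ⟩
  + a ℤ.* + b ℤ.- + a ℤ.* + c        ≡⟨ cong₂ ℤ._-_ (ℤ.pos-* a b) (ℤ.pos-* a c) ⟨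
  + (a * b) ℤ.- + (a * c)            ∎
  where open ≡-Reasoning

theorem2p17 : (G : Graph) (m : ℕ) → 1 ≤ m →
    (k : ℕ) (c : Fin (n G) → Fin k) (k′ : ℕ) (c′ : Fin (n G) → Fin k′) →
    IsComponentPartition G m k c → IsComponentPartition G (suc m) k′ c′ →
    ((+ suc m) ℤ.* Omega G m k c ℤ.≤ (+ m) ℤ.* Omega G (suc m) k′ c′) ×
    (Omega G (suc m) k′ c′ ℤ.≤ + (suc m * n G))
theorem2p17 G m _ k c k′ c′ part part′ =
  subst₂ ℤ._≤_ (sym (*-distribˡ-⁺- (suc m) (m * k) a)) (sym (*-distribˡ-⁺- m (suc m * k′) a′))
    (a+d≤b+c⇒a-c≤b-d (suc m * (m * k)) (m * (suc m * k′)) (suc m * a) (m * a′) bound) ,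
  -- Crossing edges only lower `Omega`, and nonempty parts number at most `n G`.
  ℤ.≤-trans (ℤ.i-j≤i (+ (suc m * k′)) (+ a′))
    (ℤ.+≤+ (ℕ.*-monoʳ-≤ (suc m) (surjective⇒≤ c′ (proj₁ part′))))
  where
  open ℕ.≤-Reasoning
  a  = crossing G c
  a′ = crossing G c′
  regroup : ∀ x y → suc m * (m * x) + m * y ≡ m * (y + suc m * x)
  regroup x y = trans (ℕ.+-comm _ (m * y))
    (trans (cong (λ z → m * y + z) (x∙yz≈y∙xz (suc m) m x)) (sym (ℕ.*-distribˡ-+ m y (suc m * x))))
  bound : suc m * (m * k) + m * a′ ≤ m * (suc m * k′) + suc m * a
  bound = begin
    suc m * (m * k) + m * a′        ≡⟨ regroup k a′ ⟩
    m * (a′ + suc m * k)            ≤⟨ ℕ.*-monoʳ-≤ m (crossing-bound G part part′) ⟩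
    m * (a + suc m * k′)            ≡⟨ regroup k′ a ⟨
    -- Enlarging `m * a` to `suc m * a` gives the coefficient from `suc m` times `Omega G m k c`.
    suc m * (m * k′) + m * a        ≤⟨ ℕ.+-monoʳ-≤ (suc m * (m * k′)) (ℕ.*-monoˡ-≤ a (ℕ.n≤1+n m)) ⟩
    suc m * (m * k′) + suc m * a    ≡⟨ cong (λ z → z + suc m * a) (x∙yz≈y∙xz (suc m) m k′) ⟩
    m * (suc m * k′) + suc m * a    ∎
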